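{- Let $n>1$ and let $\mathcal{G}$ be the class of all possible goals. There exists no goal-preserving acceptable encoding of $\mathrm{CHR}_{n+1,d}$ in $\mathrm{CHR}_n$ for the class $\mathcal{G}$.
   Context: **CHR.** Fix a signature whose predicate symbols are split into two disjoint sets $\Pi_b$ (built-in) and $\Pi_u$ (user-defined), and a first-order theory $CT$ giving the meaning of built-ins. Built-in constraints are given by $c::=a\mid c\wedge c\mid\exists_x c$ with $a$ an atomic formula over $\Pi_b$; a user-defined constraint is an atomic formula over $\Pi_u$. Conjunctions of atomic constraints are treated as multisets; "," denotes conjunction (multiset union); ${\tt true}$ is the empty multiset of built-in constraints. $Fv(\phi)$ is the set of free variables of $\phi$, and $\exists_{ -V}\phi$ is the existential closure of $\phi$ except for the variables in $V$. $p(\bar t)=p(\bar t')$ denotes the componentwise equalities $\bar t=\bar t'$ (undefined for different predicate symbols), extended in the expected way to multisets of constraints. A simplification rule has the form $H\Leftrightarrow C\mid B$ and a propagation rule the form $H\Rightarrow C\mid B$, where the head $H$ is a nonempty multiset of user-defined constraints, the guard $C$ a multiset of built-in constraints, and the body $B$ a multiset of constraints of both kinds. A program is a finite set of rules; a goal is a multiset of constraints of both kinds. Configurations are triples $\langle G,K,d\rangle$ ($G$ the constraints still to be solved, $K$ the accumulated user-defined constraints, $d$ a built-in constraint). For a program $P$, the relation $\longrightarrow$ is the least one such that: - Solve: $\langle (c,G),K,d\rangle\longrightarrow\langle G,K,d'\rangle$ if $c$ is built-in and $CT\models c\wedge d\leftrightarrow d'$; - Introduce: $\langle (h,G),K,d\rangle\longrightarrow\langle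 G,(h,K),d\rangle$ if $h$ is user-defined; - Simplify: $\langle G,H'\wedge K,d\rangle\longrightarrow\langle B\wedge G,K,H=H'\wedge d\rangle$ if $(H\Leftrightarrow C\mid B)\in P$, $x=Fv(H)$ and $CT\models d\rightarrow\exists_x((H=H')\wedge C)$; - Propagate: $\langle G,H'\wedge K,d\rangle\longrightarrow\langle B\wedge G,H'\wedge K,H=H'\wedge d\rangle$ if $(H\Rightarrow C\mid B)\in P$, $x=Fv(H)$ and $CT\models d\rightarrow\exists_x((H=H')\wedge C)$. In Simplify and Propagate the program rule is renamed with fresh variables. The data sufficient answers of $G$ in $P$ are $$\mathcal{SA}_P(G)=\{\exists_{ -Fv(G)}d\mid\langle G,\emptyset,\emptyset\rangle\longrightarrow^*\langle\emptyset,\emptyset,d\rangle\not\longrightarrow\}.$$ Answers are read up to logical equivalence under $CT$. A data sufficient answer for the goal $G$ in $P$ is trivial if it is equal to $G$, and non trivial otherwise. **Dialects.** $\mathrm{CHR}_n$ is the CHR language where the number of atoms in the head of each rule is at most $n$. $\mathrm{CHR}_{n,d}$ consists of the $\mathrm{CHR}_n$ programs which have (for some goal) non trivial data sufficient answers. **Goal-preserving acceptable encodings.** For a CHR (sub)language $\mathrm{CHR}_x$ let $\mathcal{P}_x$ be the set of its programs and $\mathcal{G}_x$ the set of its possible goals. An acceptable encoding of $\mathrm{CHR}_x$ into $\mathrm{CHR}_y$ for the class of goals $\mathcal{G}$ is a pair of mappings $[\![\ ]\!]:\mathcal{P}_x\to\mathcal{P}_y$ and $[\![\ ]\!]_g:\mathcal{G}_x\to\mathcal{G}_y$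 such that: (1) $\mathcal{P}_x$ and $\mathcal{P}_y$ share the same $CT$; (2) for any goal $(A,B)\in\mathcal{G}_x$, $[\![A,B]\!]_g=[\![A]\!]_g,[\![B]\!]_g$, and the built-ins present in the goal are left unchanged; (3) for all $P\in\mathcal{P}_x$ and $G\in\mathcal{G}$, $\mathcal{SA}_P(G)=\mathcal{SA}_{[\![P]\!]}([\![G]\!]_g)$. It is goal-preserving if $[\![\ ]\!]_g$ is the identity. -}

module Defs where

open import Level using (Level; 0ℓ; _⊔_) renaming (suc to lsuc)
open import Data.Nat using (ℕ; _≤_; _≟_)
open import Data.Bool using (if_then_else_)
open import Data.Product using (Σ; ∃; ∃-syntax; _×_; proj₁; proj₂)
open import Data.Sum using (_⊎_; inj₁; inj₂)
open import Data.Empty using (⊥)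
open import Data.Unit using (⊤)
open import Data.Vec using (Vec; []; _∷_)
import Data.Vec as Vec
open import Data.List using (List; []; _∷_; _++_; map; foldr; filter; concatMap)
open import Data.List.NonEmpty using (List⁺)
import Data.List.NonEmpty as List⁺
open import Data.List.Membership.Propositional using (_∈_; _∉_)
open import Data.List.Membership.DecPropositional _≟_ using (_∉?_)
open import Data.List.Relation.Unary.All using (All)
open import Data.List.Relation.Unary.Any using (Any)
open import Data.List.Relation.Binary.Permutation.Propositional using (_↭_)
open import Function using (_∘_)
open import Function.Definitions using (Injective)
open import Relation.Binary.Construct.Closure.ReflexiveTransitive using (Star)
open import Relation.Binary.PropositionalEquality using (_≡_)
open import Relation.Nullary using (¬_)
open import Relation.Nullary.Decidable using (⌊_⌋; ¬?)
open import Relation.Unary using (Pred)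

-- Πb lists the built-in predicate symbols other than equality; equality is
-- always available as a built-in and is interpreted as identity.
record Signature : Set₁ where
  field
    Fun Πb Πu : Set
    arity     : Fun → ℕ
    arityᵇ    : Πb → ℕ
    arityᵘ    : Πu → ℕ

open Signature public

Var : Set
Var = ℕ

module _ (S : Signature) where

  data Term : Set where
    var : Var → Term
    fun : (f : Fun S) → Vec Term (arity S f) → Term

  data Builtinᵃ : Set where
    app : (p : Πb S) → Vec Term (arityᵇ S p) → Builtinᵃ
    _≐_ : Term → Term → Builtinᵃ

  data Userᵃ : Set where
    app : (p : Πu S) → Vec Term (arityᵘ S p) → Userᵃ

  data Builtin : Set where
    atom : Builtinᵃ → Builtin
    _∧_  : Builtin → Builtin → Builtin
    ex   : Var → Builtin → Builtin

  data Constraint : Set where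
    builtin : Builtin → Constraint
    user    : Userᵃ → Constraint

  data Formula (A : Set) : Set where
    atom        : A → Formula A
    true false  : Formula A
    _∧_ _∨_ _⇒_ : Formula A → Formula A → Formula A
    all ex      : Var → Formula A → Formula A

  Theory : Set₁
  Theory = Pred (Formula Builtinᵃ) 0ℓ

  record Structure : Set₁ where
    field
      Carrier   : Set
      inhabited : Carrier
      ⟦fun⟧     : (f : Fun S) → Vec Carrier (arity S f) → Carrier
      ⟦Πb⟧      : (p : Πb S) → Vec Carrier (arityᵇ S p) → Set
      ⟦Πu⟧      : (p : Πu S) → Vec Carrier (arityᵘ S p) → Set

  -- All multisets are lists taken up to permutation (_↭_).
  Goal : Set
  Goal = List Constraint

  data Kind : Set where
    simplification propagation : Kind

  record Rule : Set where
    constructor rule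
    field
      kind  : Kind
      head  : List⁺ Userᵃ
      guard : List Builtin
      body  : Goal

  Program : Set
  Program = List Rule

  record Config : Set where
    constructor ⟨_,_,_⟩
    field
      goal   : Goal
      users  : List Userᵃ
      store  : List Builtin

module _ {S : Signature} where

  _⇔ᶠ_ : ∀ {A} → Formula S A → Formula S A → Formula S A
  φ ⇔ᶠ ψ = (φ ⇒ ψ) ∧ (ψ ⇒ φ)

  -- Formulas, possibly open, over built-in and user-defined predicates.
  BUFormula : Set
  BUFormula = Formula S (Builtinᵃ S ⊎ Userᵃ S)

  fromBuiltin : Builtin S → BUFormula
  fromBuiltin (atom a) = atom (inj₁ a)
  fromBuiltin (c ∧ d)  = fromBuiltin c ∧ fromBuiltin d
  fromBuiltin (ex x c) = ex x (fromBuiltin c)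

  fromConstraint : Constraint S → BUFormula
  fromConstraint (builtin c) = fromBuiltin c
  fromConstraint (user a)    = atom (inj₂ a)

  ⋀ : List BUFormula → BUFormula
  ⋀ = foldr _∧_ true

  ⋀ᵇ : List (Builtin S) → BUFormula
  ⋀ᵇ = ⋀ ∘ map fromBuiltin

  ⋀ᵍ : Goal S → BUFormula
  ⋀ᵍ = ⋀ ∘ map fromConstraint

  exs : List Var → BUFormula → BUFormula
  exs xs φ = foldr ex φ xs

  mutual
    fvᵗ : Term S → List Var
    fvᵗ (var x)    = x ∷ []
    fvᵗ (fun f ts) = fvᵗˢ ts

    fvᵗˢ : ∀ {k} → Vec (Term S) k → List Var
    fvᵗˢ []       = []
    fvᵗˢ (t ∷ ts) = fvᵗ t ++ fvᵗˢ ts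

  fvᵘ : Userᵃ S → List Var
  fvᵘ (app p ts) = fvᵗˢ ts

  fvᵇ : Builtin S → List Var
  fvᵇ (atom (app p ts)) = fvᵗˢ ts
  fvᵇ (atom (s ≐ t))    = fvᵗ s ++ fvᵗ t
  fvᵇ (c ∧ d)           = fvᵇ c ++ fvᵇ d
  fvᵇ (ex x c)          = filter (λ y → ¬? (y ≟ x)) (fvᵇ c)

  fvᶜ : Constraint S → List Var
  fvᶜ (builtin c) = fvᵇ c
  fvᶜ (user a)    = fvᵘ a

  fvᵍ : Goal S → List Var
  fvᵍ = concatMap fvᶜ

  fvᵘˢ : List (Userᵃ S) → List Var
  fvᵘˢ = concatMap fvᵘ

  fvᵇˢ : List (Builtin S) → List Var
  fvᵇˢ = concatMap fvᵇ

  fvRule : Rule S → List Var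
  fvRule (rule _ H C B) = fvᵘˢ (List⁺.toList H) ++ fvᵇˢ C ++ fvᵍ B

  fvConfig : Config S → List Var
  fvConfig ⟨ G , K , d ⟩ = fvᵍ G ++ fvᵘˢ K ++ fvᵇˢ d

  ex-except : List Var → List (Builtin S) → BUFormula
  ex-except V d = exs (filter (_∉? V) (fvᵇˢ d)) (⋀ᵇ d)

  -- Renamings act on bound variables too; as only injective ones are used to
  -- take variants of rules, no variable is captured.
  module _ (σ : Var → Var) where

    mutual
      renameᵗ : Term S → Term S
      renameᵗ (var x)    = var (σ x)
      renameᵗ (fun f ts) = fun f (renameᵗˢ ts)

      renameᵗˢ : ∀ {k} → Vec (Term S) k → Vec (Term S) k
      renameᵗˢ []       = []
      renameᵗˢ (t ∷ ts) = renameᵗ t ∷ renameᵗˢ ts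

    renameᵘ : Userᵃ S → Userᵃ S
    renameᵘ (app p ts) = app p (renameᵗˢ ts)

    renameᵇ : Builtin S → Builtin S
    renameᵇ (atom (app p ts)) = atom (app p (renameᵗˢ ts))
    renameᵇ (atom (s ≐ t))    = atom (renameᵗ s ≐ renameᵗ t)
    renameᵇ (c ∧ d)           = renameᵇ c ∧ renameᵇ d
    renameᵇ (ex x c)          = ex (σ x) (renameᵇ c)

    renameᶜ : Constraint S → Constraint S
    renameᶜ (builtin c) = builtin (renameᵇ c)
    renameᶜ (user a)    = user (renameᵘ a)

    renameRule : Rule S → Rule S
    renameRule (rule k H C B) =
      rule k (List⁺.map renameᵘ H) (map renameᵇ C) (map renameᶜ B)

  module _ (M : Structure S) where
    open Structure M

    Assignment : Set
    Assignment = Var → Carrier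

    _[_↦_] : Assignment → Var → Carrier → Assignment
    (ρ [ x ↦ a ]) y = if ⌊ y ≟ x ⌋ then a else ρ y

    mutual
      evalᵗ : Assignment → Term S → Carrier
      evalᵗ ρ (var x)    = ρ x
      evalᵗ ρ (fun f ts) = ⟦fun⟧ f (evalᵗˢ ρ ts)

      evalᵗˢ : ∀ {k} → Assignment → Vec (Term S) k → Vec Carrier k
      evalᵗˢ ρ []       = []
      evalᵗˢ ρ (t ∷ ts) = evalᵗ ρ t ∷ evalᵗˢ ρ ts

    satᵇ : Assignment → Builtinᵃ S → Set
    satᵇ ρ (app p ts) = ⟦Πb⟧ p (evalᵗˢ ρ ts)
    satᵇ ρ (s ≐ t)    = evalᵗ ρ s ≡ evalᵗ ρ t

    satᵘ : Assignment → Userᵃ S → Set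
    satᵘ ρ (app p ts) = ⟦Πu⟧ p (evalᵗˢ ρ ts)

    satᵇᵘ : Assignment → Builtinᵃ S ⊎ Userᵃ S → Set
    satᵇᵘ ρ (inj₁ a) = satᵇ ρ a
    satᵇᵘ ρ (inj₂ a) = satᵘ ρ a

    sat : ∀ {A} → (Assignment → A → Set) → Assignment → Formula S A → Set
    sat at ρ (atom a)  = at ρ a
    sat at ρ true      = ⊤
    sat at ρ false     = ⊥
    sat at ρ (φ ∧ ψ)   = sat at ρ φ × sat at ρ ψ
    sat at ρ (φ ∨ ψ)   = sat at ρ φ ⊎ sat at ρ ψ
    sat at ρ (φ ⇒ ψ)   = sat at ρ φ → sat at ρ ψ
    sat at ρ (all x φ) = (a : Carrier) → sat at (ρ [ x ↦ a ]) φ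
    sat at ρ (ex x φ)  = ∃[ a ] sat at (ρ [ x ↦ a ]) φ

    IsModel : Theory S → Set
    IsModel CT = ∀ φ → CT φ → ∀ ρ → sat satᵇ ρ φ

  -- Free variables are read as universally quantified. CT does not constrain
  -- the user-defined predicates, which therefore range over all
  -- interpretations.
  _⊨_ : Theory S → BUFormula → Set₁
  CT ⊨ φ = ∀ M → IsModel M CT → ∀ ρ → sat M (satᵇᵘ M) ρ φ

  Consistent : Theory S → Set₁
  Consistent CT = ¬ (CT ⊨ false)

  -- EqAtoms H H' E: E is the conjunction of equalities H = H', pairing atoms
  -- in list order. It is uninhabited if paired predicate symbols differ. As H'
  -- is only ever fixed up to permutation, every pairing can be chosen.
  data EqAtom : Userᵃ S → Userᵃ S → List (Builtin S) → Set where
    eq-args : ∀ {p} {ts us : Vec (Term S) (arityᵘ S p)} →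
              EqAtom (app p ts) (app p us)
                     (Vec.toList (Vec.zipWith (λ t u → atom (t ≐ u)) ts us))

  data EqAtoms : List (Userᵃ S) → List (Userᵃ S) → List (Builtin S) → Set where
    []  : EqAtoms [] [] []
    _∷_ : ∀ {h h' H H' e E} → EqAtom h h' e → EqAtoms H H' E →
          EqAtoms (h ∷ H) (h' ∷ H') (e ++ E)

  -- Variants with respect to the variables V of the initial goal (which Solve
  -- may have eliminated from the configuration) and the current configuration.
  record FreshVariant (V : List Var) (c : Config S) (r r' : Rule S) : Set where
    field
      σ         : Var → Var
      injective : Injective _≡_ _≡_ σ
      renamed   : r' ≡ renameRule σ r
      fresh     : All (_∉ (V ++ fvConfig c)) (fvRule r')

module _ {S : Signature} (CT : Theory S) where

  Applicable : List (Builtin S) → List⁺ (Userᵃ S) → List (Builtin S) →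
               List (Builtin S) → Set₁
  Applicable d H E C =
    CT ⊨ (⋀ᵇ d ⇒ exs (fvᵘˢ (List⁺.toList H)) (⋀ᵇ E ∧ ⋀ᵇ C))

  data Step (P : Program S) (V : List Var) : Config S → Config S → Set₁ where

    solve : ∀ {G₀ c G K d d'} →
      G₀ ↭ builtin c ∷ G →
      CT ⊨ ((fromBuiltin c ∧ ⋀ᵇ d) ⇔ᶠ ⋀ᵇ d') →
      Step P V ⟨ G₀ , K , d ⟩ ⟨ G , K , d' ⟩

    introduce : ∀ {G₀ h G K d} →
      G₀ ↭ user h ∷ G →
      Step P V ⟨ G₀ , K , d ⟩ ⟨ G , h ∷ K , d ⟩

    simplify : ∀ {G K₀ H' K d r H C B E} →
      r ∈ P →
      FreshVariant V ⟨ G , K₀ , d ⟩ r (rule simplification H C B) →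
      K₀ ↭ H' ++ K →
      EqAtoms (List⁺.toList H) H' E →
      Applicable d H E C →
      Step P V ⟨ G , K₀ , d ⟩ ⟨ B ++ G , K , E ++ d ⟩

    propagate : ∀ {G K₀ H' K d r H C B E} →
      r ∈ P →
      FreshVariant V ⟨ G , K₀ , d ⟩ r (rule propagation H C B) →
      K₀ ↭ H' ++ K →
      EqAtoms (List⁺.toList H) H' E →
      Applicable d H E C →
      Step P V ⟨ G , K₀ , d ⟩ ⟨ B ++ G , H' ++ K , E ++ d ⟩

  SA : Program S → Goal S → Pred (BUFormula {S}) (lsuc 0ℓ)
  SA P G φ = ∃[ d ]
      φ ≡ ex-except (fvᵍ G) d
    × Star (Step P (fvᵍ G)) ⟨ G , [] , [] ⟩ ⟨ [] , [] , d ⟩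
    × ¬ (∃[ c ] Step P (fvᵍ G) ⟨ [] , [] , d ⟩ c)

  _⊆ᴬ_ : Pred (BUFormula {S}) (lsuc 0ℓ) → Pred (BUFormula {S}) (lsuc 0ℓ) → Set₁
  A ⊆ᴬ B = ∀ φ → A φ → ∃[ ψ ] B ψ × CT ⊨ (φ ⇔ᶠ ψ)

  -- Equality of sets of answers, each answer read up to equivalence under CT.
  _≈ᴬ_ : Pred (BUFormula {S}) (lsuc 0ℓ) → Pred (BUFormula {S}) (lsuc 0ℓ) → Set₁
  A ≈ᴬ B = (A ⊆ᴬ B) × (B ⊆ᴬ A)

  -- As G may contain user-defined atoms, equality with G is equivalence under
  -- CT over the whole signature.
  Trivial : Goal S → BUFormula {S} → Set₁
  Trivial G φ = CT ⊨ (φ ⇔ᶠ ⋀ᵍ G)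

  HasNonTrivialAnswer : Program S → Set₁
  HasNonTrivialAnswer P = ∃[ G ] ∃[ φ ] SA P G φ × ¬ Trivial G φ

module _ {S : Signature} where

  CHR : ℕ → Pred (Program S) 0ℓ
  CHR n P = All (λ r → List⁺.length (Rule.head r) ≤ n) P

  CHRᵈ : Theory S → ℕ → Pred (Program S) (lsuc 0ℓ)
  CHRᵈ CT n P = CHR n P × HasNonTrivialAnswer CT P

  record _≈ʳ_ (r s : Rule S) : Set where
    open Rule
    field
      kind-≡  : kind r ≡ kind s
      head-↭  : List⁺.toList (head r) ↭ List⁺.toList (head s)
      guard-↭ : guard r ↭ guard s
      body-↭  : body r ↭ body s

  -- Equality of programs as finite sets of rules.
  _≈ᴾ_ : Program S → Program S → Set
  P ≈ᴾ Q = All (λ r → Any (r ≈ʳ_) Q) P × All (λ s → Any (s ≈ʳ_) P) Q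

-- Both languages are sublanguages of CHR over one signature and one CT, and
-- the goals of each are all the goals over that signature. The two congruence
-- fields say that the mappings act on programs as sets and goals as multisets.
record AcceptableEncoding {S : Signature} (CT : Theory S) {ℓx ℓy ℓ : Level}
       (𝒫x : Pred (Program S) ℓx) (𝒫y : Pred (Program S) ℓy)
       (𝒢 : Pred (Goal S) ℓ) : Set (lsuc 0ℓ ⊔ ℓx ⊔ ℓy ⊔ ℓ) where
  field
    ⟦_⟧           : Σ (Program S) 𝒫x → Σ (Program S) 𝒫y
    ⟦⟧-cong       : ∀ P Q → proj₁ P ≈ᴾ proj₁ Q → proj₁ ⟦ P ⟧ ≈ᴾ proj₁ ⟦ Q ⟧
    ⟦_⟧g          : Goal S → Goal S
    ⟦⟧g-cong      : ∀ A B → A ↭ B → ⟦ A ⟧g ↭ ⟦ B ⟧g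
    compositional : ∀ A B → ⟦ A ++ B ⟧g ↭ ⟦ A ⟧g ++ ⟦ B ⟧g
    builtins      : ∀ c → ⟦ builtin c ∷ [] ⟧g ↭ builtin c ∷ []
    answers       : ∀ P G → 𝒢 G →
                    _≈ᴬ_ CT (SA CT (proj₁ P) G) (SA CT (proj₁ ⟦ P ⟧) ⟦ G ⟧g)

  GoalPreserving : Set
  GoalPreserving = ∀ G → ⟦ G ⟧g ↭ G

-- Let P consist of the single rule a, …, a ⇔ true with n + 1 copies of an atom a.
-- It solves the goal of n + 1 copies of a, non-trivially, but no goal with
-- between 1 and n user-defined atoms, since its rule can then never fire. A
-- program with heads of size at most n that also solves a, …, a has, in its
-- derivation, a last step before which user-defined constraints are present. This
-- step is a simplification whose head consumes all of them, so there are at most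
-- n, and the configuration before it, read as a goal, is solvable. Hence this
-- goal separates the two programs.
module Submission where

open import Defs
open import Data.Nat using (ℕ; zero; suc; _>_; _<_; _≤_; _≟_)
open import Data.Nat.Properties using (≤-trans; ≤-reflexive; <⇒≱; suc-injective)
open import Data.Empty using (⊥)
open import Data.Maybe using (Maybe; just; nothing)
open import Data.List using (List; []; _∷_; _++_; map; mapMaybe; length; replicate;
  concatMap; _ʳ++_; filter)
open import Data.List.Properties
  using (++-identityʳ; ++-conicalˡ; ++-conicalʳ; concatMap-++; concatMap-map; length-map;
         length-replicate; length-++-≤ˡ; length-++-≤ʳ; mapMaybe-++; mapMaybe-map-none;
         mapMaybe-map-retract)
open import Data.List.NonEmpty using (List⁺; _∷_)
import Data.List.NonEmpty as List⁺
open import Data.List.Membership.Propositional using (_∈_)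
open import Data.List.Membership.Propositional.Properties using (∈-++⁻; ∈-++⁺ʳ; ∈-++⁺ˡ; ∈-map⁺; ∈-map⁻)
open import Data.List.Membership.DecPropositional _≟_ using (_∉?_)
open import Data.List.Relation.Unary.Any using (here; there)
open import Data.List.Relation.Unary.All as All using (All; []; _∷_)
import Data.List.Relation.Unary.All.Properties as All
open import Data.List.Relation.Binary.Subset.Propositional using (_⊆_)
open import Data.List.Relation.Binary.Subset.Propositional.Properties using (concatMap⁺; ⊆-reflexive-↭)
open import Data.List.Relation.Binary.Permutation.Propositional
  using (_↭_; ↭-refl; ↭-sym; ↭-trans; ↭-reflexive)
open import Data.List.Relation.Binary.Permutation.Propositional.Properties
  using (shift; ++⁺ˡ; ++⁺ʳ; ↭-length; ¬x∷xs↭[]; ↭-empty-inv; mapMaybe-↭; ∈-resp-↭; ↭-reverse)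
open import Data.Product using (Σ; ∃-syntax; _×_; _,_; proj₁; proj₂)
open import Data.Sum using (_⊎_; inj₁; inj₂; [_,_]′)
open import Data.Unit using (tt)
open import Data.Vec using (Vec; []; _∷_)
import Data.Vec as Vec
open import Function using (_∘_; id; const)
open import Relation.Binary.Construct.Closure.ReflexiveTransitive using (Star; ε; _◅_; _◅◅_)
open import Relation.Binary.PropositionalEquality
  using (_≡_; _≢_; refl; sym; trans; cong; cong₂; subst)
open import Relation.Nullary using (¬_; yes; no; contradiction)
open import Relation.Unary using (U)

-- Configurations read as goals

module _ {S : Signature} where

  isUser : Constraint S → Maybe (Userᵃ S)
  isUser (builtin _) = nothing
  isUser (user a)    = just a

  usersᵍ : Goal S → List (Userᵃ S)
  usersᵍ = mapMaybe isUser

  users : Config S → List (Userᵃ S)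
  users ⟨ G , K , d ⟩ = usersᵍ G ++ K

  -- A derivation from this goal can introduce `K` and solve `d` again, which recovers the
  -- constraints of the configuration without its history.
  toGoal : Config S → Goal S
  toGoal ⟨ G , K , d ⟩ = G ++ map user K ++ map builtin d

  usersᵍ-↭ : ∀ {G G'} → G ↭ G' → usersᵍ G ↭ usersᵍ G'
  usersᵍ-↭ = mapMaybe-↭ isUser

  usersᵍ-user : ∀ K → usersᵍ (map user K) ≡ K
  usersᵍ-user = mapMaybe-map-retract λ _ → refl

  usersᵍ-toGoal : ∀ c → usersᵍ (toGoal c) ≡ users c
  usersᵍ-toGoal ⟨ G , K , d ⟩ =
    trans (mapMaybe-++ isUser G _) (cong (usersᵍ G ++_)
      (trans (mapMaybe-++ isUser (map user K) _)
        (trans (cong₂ _++_ (usersᵍ-user K) (mapMaybe-map-none (λ _ → refl) d))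
               (++-identityʳ K))))

  fvᵍ-toGoal : ∀ c → fvᵍ (toGoal c) ≡ fvConfig c
  fvᵍ-toGoal ⟨ G , K , d ⟩ =
    trans (concatMap-++ fvᶜ G _) (cong (fvᵍ G ++_)
      (trans (concatMap-++ fvᶜ (map user K) _)
             (cong₂ _++_ (concatMap-map fvᶜ user K) (concatMap-map fvᶜ builtin d))))

  fvConfig-↭ : ∀ c {G} → G ↭ toGoal c → fvᵍ G ⊆ fvConfig c
  fvConfig-↭ c G↭c x∈ =
    subst (_ ∈_) (fvᵍ-toGoal c) (concatMap⁺ fvᶜ (⊆-reflexive-↭ G↭c) x∈)

  EqAtoms-length : ∀ {H H' : List (Userᵃ S)} {E} → EqAtoms H H' E → length H ≡ length H'
  EqAtoms-length []      = refl
  EqAtoms-length (_ ∷ p) = cong suc (EqAtoms-length p)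

  ∈-builtins : ∀ {c : Builtin S} K d → builtin c ∈ map user K ++ map builtin d → c ∈ d
  ∈-builtins K d c∈ with ∈-++⁻ (map user K) c∈
  ... | inj₁ c∈K with ∈-map⁻ user c∈K
  ...   | _ , _ , ()
  ∈-builtins K d c∈ | inj₂ c∈d with ∈-map⁻ builtin c∈d
  ...   | _ , c∈ , refl = c∈

-- Satisfaction of conjunctions and existential closures

module _ {S : Signature} (M : Structure S) where
  open Structure M

  ⋀ᵇ-∈ : ∀ {ρ c} d → sat M (satᵇᵘ M) ρ (⋀ᵇ d) → c ∈ d → sat M (satᵇᵘ M) ρ (fromBuiltin c)
  ⋀ᵇ-∈ (_ ∷ _) (s , _) (here refl) = s
  ⋀ᵇ-∈ (_ ∷ d) (_ , s) (there c∈)  = ⋀ᵇ-∈ d s c∈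

  ⋀ᵇ-⊆ : ∀ {ρ} d e → e ⊆ d → sat M (satᵇᵘ M) ρ (⋀ᵇ d) → sat M (satᵇᵘ M) ρ (⋀ᵇ e)
  ⋀ᵇ-⊆ d []      e⊆d s = tt
  ⋀ᵇ-⊆ d (_ ∷ e) e⊆d s = ⋀ᵇ-∈ d s (e⊆d (here refl)) , ⋀ᵇ-⊆ d e (e⊆d ∘ there) s

  ⋀ᵇ-++ : ∀ {ρ} d e → sat M (satᵇᵘ M) ρ (⋀ᵇ d) → sat M (satᵇᵘ M) ρ (⋀ᵇ e) →
          sat M (satᵇᵘ M) ρ (⋀ᵇ (d ++ e))
  ⋀ᵇ-++ []      e _        t = t
  ⋀ᵇ-++ (_ ∷ d) e (s , s') t = s , ⋀ᵇ-++ d e s' t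

  update-const : ∀ (ρ : Assignment M) x {y v} → y ≡ x ⊎ ρ y ≡ v → (_[_↦_] M ρ x v) y ≡ v
  update-const ρ x {y} h with y ≟ x | h
  ... | yes _   | _        = refl
  ... | no y≢x | inj₁ y≡x = contradiction y≡x y≢x
  ... | no _   | inj₂ eq  = eq

  -- Assigning the same value to all quantified variables avoids
  -- distinguishing repeated ones.
  exs-const : ∀ xs ρ v φ →
    (∀ τ → (∀ y → y ∈ xs ⊎ ρ y ≡ v → τ y ≡ v) → sat M (satᵇᵘ M) τ φ) →
    sat M (satᵇᵘ M) ρ (exs xs φ)
  exs-const []       ρ v φ hyp = hyp ρ λ { y (inj₂ eq) → eq }
  exs-const (x ∷ xs) ρ v φ hyp = v , exs-const xs (_[_↦_] M ρ x v) v φ λ τ h → hyp τ λ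
    { y (inj₁ (here eq))  → h y (inj₂ (update-const ρ x (inj₁ eq)))
    ; y (inj₁ (there y∈)) → h y (inj₁ y∈)
    ; y (inj₂ eq)         → h y (inj₂ (update-const ρ x (inj₂ eq))) }

  -- Models with empty user-defined predicates

  withoutUsers : Structure S
  withoutUsers = record { Structure M ; ⟦Πu⟧ = λ _ _ → ⊥ }

  mutual
    evalᵗ-withoutUsers : ∀ ρ t → evalᵗ withoutUsers ρ t ≡ evalᵗ M ρ t
    evalᵗ-withoutUsers ρ (var x)    = refl
    evalᵗ-withoutUsers ρ (fun f ts) = cong (⟦fun⟧ f) (evalᵗˢ-withoutUsers ρ ts)

    evalᵗˢ-withoutUsers : ∀ {k} ρ (ts : Vec (Term S) k) →
                          evalᵗˢ withoutUsers ρ ts ≡ evalᵗˢ M ρ ts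
    evalᵗˢ-withoutUsers ρ []       = refl
    evalᵗˢ-withoutUsers ρ (t ∷ ts) =
      cong₂ _∷_ (evalᵗ-withoutUsers ρ t) (evalᵗˢ-withoutUsers ρ ts)

  mutual
    -- Formulas of a theory mention only built-ins, so emptying the user-defined predicates changes
    -- nothing. Both directions are proved together since implication swaps them.
    sat-withoutUsers⁺ : ∀ φ ρ → sat M (satᵇ M) ρ φ → sat withoutUsers (satᵇ withoutUsers) ρ φ
    sat-withoutUsers⁺ (atom (app p ts)) ρ s =
      subst (⟦Πb⟧ p) (sym (evalᵗˢ-withoutUsers ρ ts)) s
    sat-withoutUsers⁺ (atom (t ≐ u)) ρ s =
      trans (evalᵗ-withoutUsers ρ t) (trans s (sym (evalᵗ-withoutUsers ρ u)))
    sat-withoutUsers⁺ true      ρ s        = tt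
    sat-withoutUsers⁺ (φ ∧ ψ)   ρ (s , t)  = sat-withoutUsers⁺ φ ρ s , sat-withoutUsers⁺ ψ ρ t
    sat-withoutUsers⁺ (φ ∨ ψ)   ρ (inj₁ s) = inj₁ (sat-withoutUsers⁺ φ ρ s)
    sat-withoutUsers⁺ (φ ∨ ψ)   ρ (inj₂ s) = inj₂ (sat-withoutUsers⁺ ψ ρ s)
    sat-withoutUsers⁺ (φ ⇒ ψ)   ρ s        = sat-withoutUsers⁺ ψ ρ ∘ s ∘ sat-withoutUsers⁻ φ ρ
    sat-withoutUsers⁺ (all x φ) ρ s        = λ a → sat-withoutUsers⁺ φ _ (s a)
    sat-withoutUsers⁺ (ex x φ)  ρ (a , s)  = a , sat-withoutUsers⁺ φ _ s

    sat-withoutUsers⁻ : ∀ φ ρ → sat withoutUsers (satᵇ withoutUsers) ρ φ → sat M (satᵇ M) ρ φ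
    sat-withoutUsers⁻ (atom (app p ts)) ρ s =
      subst (⟦Πb⟧ p) (evalᵗˢ-withoutUsers ρ ts) s
    sat-withoutUsers⁻ (atom (t ≐ u)) ρ s =
      trans (sym (evalᵗ-withoutUsers ρ t)) (trans s (evalᵗ-withoutUsers ρ u))
    sat-withoutUsers⁻ true      ρ s        = tt
    sat-withoutUsers⁻ (φ ∧ ψ)   ρ (s , t)  = sat-withoutUsers⁻ φ ρ s , sat-withoutUsers⁻ ψ ρ t
    sat-withoutUsers⁻ (φ ∨ ψ)   ρ (inj₁ s) = inj₁ (sat-withoutUsers⁻ φ ρ s)
    sat-withoutUsers⁻ (φ ∨ ψ)   ρ (inj₂ s) = inj₂ (sat-withoutUsers⁻ ψ ρ s)
    sat-withoutUsers⁻ (φ ⇒ ψ)   ρ s        = sat-withoutUsers⁻ ψ ρ ∘ s ∘ sat-withoutUsers⁺ φ ρ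
    sat-withoutUsers⁻ (all x φ) ρ s        = λ a → sat-withoutUsers⁻ φ _ (s a)
    sat-withoutUsers⁻ (ex x φ)  ρ (a , s)  = a , sat-withoutUsers⁻ φ _ s

  IsModel-withoutUsers : ∀ {CT} → IsModel M CT → IsModel withoutUsers CT
  IsModel-withoutUsers m φ φ∈ ρ = sat-withoutUsers⁺ φ ρ (m φ φ∈ ρ)

-- Steps that remove the last user-defined constraints

module _ {S : Signature} (CT : Theory S) (P : Program S) where

  Solvable : Goal S → Set₁
  Solvable G = ∃[ φ ] SA CT P G φ

  head-length : ∀ {V c} {r r' : Rule S} → FreshVariant V c r r' →
                List⁺.length (Rule.head r') ≡ List⁺.length (Rule.head r)
  head-length {r = rule _ (_ ∷ H) _ _} fv rewrite FreshVariant.renamed fv = cong suc (length-map _ H)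

  -- Solve and Introduce need a constraint in the goal, and the other two steps need a match for a
  -- nonempty head.
  halted : ∀ {V d} → ¬ (∃[ c ] Step CT P V ⟨ [] , [] , d ⟩ c)
  halted (_ , solve p _)                             = ¬x∷xs↭[] (↭-sym p)
  halted (_ , introduce p)                           = ¬x∷xs↭[] (↭-sym p)
  halted (_ , simplify  {H = _ ∷ _} _ _ p (_ ∷ _) _) = ¬x∷xs↭[] (↭-sym p)
  halted (_ , propagate {H = _ ∷ _} _ _ p (_ ∷ _) _) = ¬x∷xs↭[] (↭-sym p)

  solve-rest : ∀ {V} G d → usersᵍ G ≡ [] →
               ∃[ d' ] Star (Step CT P V) ⟨ G , [] , d ⟩ ⟨ [] , [] , d' ⟩
  solve-rest []              d eq = d , ε
  solve-rest (builtin c ∷ G) d eq with solve-rest G (c ∷ d) eq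
  -- The new store is literally `c ∷ d`, so the equivalence required by Solve is the identity.
  ... | d' , run = d' , solve ↭-refl (λ _ _ _ → id , id) ◅ run

  introduce-all : ∀ {V} K K₀ d →
    Star (Step CT P V) ⟨ map user K , K₀ , d ⟩ ⟨ [] , K ʳ++ K₀ , d ⟩
  introduce-all []      K₀ d = ε
  introduce-all (h ∷ K) K₀ d = introduce ↭-refl ◅ introduce-all K (h ∷ K₀) d

  -- No rule is fired: constraints only move from the goal to the other two components, so the
  -- multiset of all of them is preserved.
  flush : ∀ {V} G K d → ∃[ K' ] ∃[ d' ]
    Star (Step CT P V) ⟨ G , K , d ⟩ ⟨ [] , K' , d' ⟩ ×
    toGoal ⟨ [] , K' , d' ⟩ ↭ toGoal ⟨ G , K , d ⟩
  flush []              K d = K , d , ε , ↭-refl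
  flush (builtin c ∷ G) K d with flush G K (c ∷ d)
  ... | K' , d' , run , p = K' , d' , solve ↭-refl (λ _ _ _ → id , id) ◅ run ,
    ↭-trans p (↭-trans (++⁺ˡ G (shift (builtin c) (map user K) _)) (shift (builtin c) G _))
  flush (user h ∷ G)    K d with flush G (h ∷ K) d
  ... | K' , d' , run , p = K' , d' , introduce ↭-refl ◅ run , ↭-trans p (shift (user h) G _)

  users-solve : ∀ {G₀ c} {G : Goal S} K → G₀ ↭ builtin c ∷ G → usersᵍ G₀ ++ K ↭ usersᵍ G ++ K
  users-solve K p = ++⁺ʳ K (usersᵍ-↭ p)

  users-introduce : ∀ {G₀ h} {G : Goal S} K → G₀ ↭ user h ∷ G → usersᵍ G₀ ++ K ↭ usersᵍ G ++ h ∷ K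
  users-introduce {h = h} {G} K p =
    ↭-trans (++⁺ʳ K (usersᵍ-↭ p)) (↭-sym (shift h (usersᵍ G) K))

  -- Freshness survives restarting from the configuration c read as a goal,
  -- because the variables of that goal are exactly those of c.
  vanish : ∀ {V c c'} → Step CT P V c c' → users c ≢ [] → users c' ≡ [] →
    (∃[ r ] r ∈ P × length (users c) ≡ List⁺.length (Rule.head r)) ×
    (∀ G → G ↭ toGoal c → Solvable G)
  vanish (solve {K = K} p _) ne eq =
    contradiction (↭-empty-inv (subst (_ ↭_) eq (users-solve K p))) ne
  vanish (introduce {K = K} p) ne eq =
    contradiction (↭-empty-inv (subst (_ ↭_) eq (users-introduce K p))) ne
  -- Propagation keeps the nonempty match of its head.
  vanish (propagate {G} {H = _ ∷ _} {B = B} _ _ _ (_ ∷ _) _) ne eq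
    with () ← ++-conicalʳ (usersᵍ (B ++ G)) _ eq
  vanish {V} (simplify {G} {K₀} {H'} {K} {d} {r} {H} {C} {B} {E} r∈P fv p eqs entailed) ne eq
    -- Nothing is left beside the match `H'`, so the head consumes every user-defined constraint.
    with refl ← ++-conicalʳ (usersᵍ (B ++ G)) K eq = (r , r∈P , len) , solvable
    where
    c : Config S
    c = ⟨ G , K₀ , d ⟩

    noUsers : usersᵍ B ++ usersᵍ G ≡ []
    noUsers = trans (sym (mapMaybe-++ isUser B G)) (++-conicalˡ _ K eq)

    G-empty : usersᵍ G ≡ []
    G-empty = ++-conicalʳ (usersᵍ B) _ noUsers

    K₀↭H' : K₀ ↭ H'
    K₀↭H' = subst (K₀ ↭_) (++-identityʳ H') p

    len : length (usersᵍ G ++ K₀) ≡ List⁺.length (Rule.head r)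
    len = trans (cong (λ us → length (us ++ K₀)) G-empty)
            (trans (↭-length K₀↭H') (trans (sym (EqAtoms-length eqs)) (head-length fv)))

    solvable : ∀ G' → G' ↭ toGoal c → Solvable G'
    solvable G' G'↭ with flush {fvᵍ G'} G' [] []
    ... | K' , d' , run , q = _ , _ , refl ,
          run ◅◅ simplify r∈P fv' K'↭ eqs entailed' ◅ proj₂ rest , halted
      where
      q' : toGoal ⟨ [] , K' , d' ⟩ ↭ toGoal c
      q' = ↭-trans q (↭-trans (↭-reflexive (++-identityʳ G')) G'↭)

      K'↭ : K' ↭ H' ++ []
      K'↭ = ↭-trans (↭-reflexive (sym (usersᵍ-toGoal ⟨ [] , K' , d' ⟩)))
             (↭-trans (usersᵍ-↭ q')
               (↭-trans (↭-reflexive (trans (usersᵍ-toGoal c)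
                                             (cong (_++ K₀) G-empty))) p))

      d⊆d' : d ⊆ d'
      d⊆d' c∈ = ∈-builtins K' d' (∈-resp-↭ (↭-sym q')
                  (∈-++⁺ʳ G (∈-++⁺ʳ (map user K₀) (∈-map⁺ builtin c∈))))

      -- `flush` also moves the built-ins of `G` into the store, so `d'` may be stronger than `d`;
      -- applicability survives strengthening the store.
      entailed' : Applicable CT d' H E C
      entailed' M m ρ s = entailed M m ρ (⋀ᵇ-⊆ M d' d d⊆d' s)

      fvs⊆ : fvᵍ G' ++ fvConfig ⟨ [] , K' , d' ⟩ ⊆ fvConfig c
      fvs⊆ x∈ = [ fvConfig-↭ c G'↭
                , fvConfig-↭ c q' ∘ subst (_ ∈_) (sym (fvᵍ-toGoal ⟨ [] , K' , d' ⟩)) ]′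
                (∈-++⁻ (fvᵍ G') x∈)

      fv' : FreshVariant (fvᵍ G') ⟨ [] , K' , d' ⟩ r (rule simplification H C B)
      fv' = record
        { FreshVariant fv
        ; fresh = All.map (_∘ ∈-++⁺ʳ V ∘ fvs⊆) (FreshVariant.fresh fv) }

      -- After the rule fires only its body remains, and `noUsers` makes that purely built-in.
      rest = solve-rest (B ++ []) (E ++ d')
               (trans (cong usersᵍ (++-identityʳ B)) (++-conicalˡ (usersᵍ B) _ noUsers))

  -- Follows the derivation to its first step that leaves no user-defined constraint. The bound is
  -- the head size of the rule fired there. Solvability covers all permutations because encodings
  -- fix goals only up to permutation.
  vanishing-point : ∀ {n V c d} → CHR n P → users c ≢ [] →
    Star (Step CT P V) c ⟨ [] , [] , d ⟩ →
    ∃[ G ] usersᵍ G ≢ [] × length (usersᵍ G) ≤ n × (∀ G' → G' ↭ G → Solvable G')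
  vanishing-point chr ne ε = contradiction refl ne
  vanishing-point {c = c} chr ne (_◅_ {j = c'} s run) with users c' in eq
  ... | _ ∷ _ = vanishing-point chr (λ eq' → contradiction (trans (sym eq) eq') λ ()) run
  ... | []    with vanish s ne eq
  ...   | (r , r∈P , len) , solvable = toGoal c ,
          ne ∘ trans (sym (usersᵍ-toGoal c)) ,
          ≤-trans (≤-reflexive (trans (cong length (usersᵍ-toGoal c)) len)) (All.lookup chr r∈P) ,
          solvable

  -- Programs with only large heads

  module _ {n} (large : All (λ r → n < List⁺.length (Rule.head r)) P) where

    -- A match pairs each head atom with its own accumulated constraint, and there are fewer of
    -- these than head atoms.
    ¬fires : ∀ {V c r r' H' K G K₀ E} → length (usersᵍ G ++ K₀) ≤ n → r ∈ P →
      FreshVariant V c r r' → K₀ ↭ H' ++ K →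
      ¬ EqAtoms (List⁺.toList (Rule.head r')) H' E
    ¬fires {r' = r'} {H'} {K} {G} {K₀} few r∈P fv p eqs = <⇒≱ (All.lookup large r∈P) (≤-trans
      (≤-reflexive (trans (sym (head-length fv)) (EqAtoms-length eqs)))
      (≤-trans (≤-trans (length-++-≤ˡ H') (≤-reflexive (sym (↭-length p))))
               (≤-trans (length-++-≤ʳ K₀ {usersᵍ G}) few)))

    few-users-↭ : ∀ {V c c'} → length (users c) ≤ n → Step CT P V c c' → users c ↭ users c'
    few-users-↭ few (solve {c = c} {K = K} p _) = users-solve {c = c} K p
    few-users-↭ few (introduce {K = K} p)       = users-introduce K p
    few-users-↭ few (simplify {G = G} r∈P fv p eqs _) =
      contradiction eqs (¬fires {G = G} few r∈P fv p)
    few-users-↭ few (propagate {G = G} r∈P fv p eqs _) =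
      contradiction eqs (¬fires {G = G} few r∈P fv p)

    few-users-stuck : ∀ {V c c'} → length (users c) ≤ n → Star (Step CT P V) c c' →
                      users c ↭ users c'
    few-users-stuck few ε         = ↭-refl
    few-users-stuck few (s ◅ run) = ↭-trans c↭ (few-users-stuck
        (≤-trans (≤-reflexive (sym (↭-length c↭))) few) run)
      where c↭ = few-users-↭ few s

    -- Without rule firings the multiset of user-defined constraints is invariant, whereas a
    -- successful derivation ends with none.
    few-users-unsolvable : ∀ G → usersᵍ G ≢ [] → length (usersᵍ G) ≤ n → ¬ Solvable G
    few-users-unsolvable G ne few (_ , _ , _ , run , _) = ne (↭-empty-inv
      (↭-trans (↭-reflexive (sym (++-identityʳ (usersᵍ G))))
        (few-users-stuck (≤-trans (≤-reflexive (cong length (++-identityʳ (usersᵍ G)))) few) run)))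

-- The one-rule program and its nontrivial answer

module _ {S : Signature} (CT : Theory S) (p : Πu S) (n : ℕ) where

  zeros : ∀ k → Vec (Term S) k
  zeros k = Vec.replicate k (var 0)

  -- With 0 as the only possible variable, renaming by `suc` already yields a fresh variant of the
  -- rule.
  atom₀ : Userᵃ S
  atom₀ = app p (zeros (arityᵘ S p))

  heads : List⁺ (Userᵃ S)
  heads = atom₀ ∷ replicate n atom₀

  eraser : Rule S
  eraser = rule simplification heads [] []

  goal : Goal S
  goal = map user (List⁺.toList heads)

  equations : ∀ {k} → Vec (Term S) k → List (Builtin S)
  equations ts = Vec.toList (Vec.zipWith (λ t u → atom (t ≐ u)) (renameᵗˢ suc ts) ts)

  allEquations : List (Userᵃ S) → List (Builtin S)
  allEquations = concatMap λ { (app _ ts) → equations ts }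

  allEquations-EqAtoms : ∀ H → EqAtoms (map (renameᵘ suc) H) H (allEquations H)
  allEquations-EqAtoms []             = []
  allEquations-EqAtoms (app _ ts ∷ H) = eq-args ∷ allEquations-EqAtoms H

  fv-zeros : ∀ k → All (_≡ 0) (fvᵗˢ {S} (zeros k))
  fv-zeros zero    = []
  fv-zeros (suc k) = refl ∷ fv-zeros k

  fv-ones : ∀ k → All (_≢ 0) (fvᵗˢ {S} (renameᵗˢ suc (zeros k)))
  fv-ones zero    = []
  fv-ones (suc k) = (λ ()) ∷ fv-ones k

  module _ (M : Structure S) {τ : Assignment M} {v} (τ0 : τ 0 ≡ v) where

    sat-equations : ∀ k → (∀ {y} → y ∈ fvᵗˢ {S} (renameᵗˢ suc (zeros k)) → τ y ≡ v) →
                    sat M (satᵇᵘ M) τ (⋀ᵇ (equations (zeros k)))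
    sat-equations zero    h = tt
    sat-equations (suc k) h = trans (h (here refl)) (sym τ0) , sat-equations k (h ∘ there)

    sat-allEquations : ∀ m →
      (∀ {y} → y ∈ fvᵘˢ (map (renameᵘ suc) (replicate m atom₀)) → τ y ≡ v) →
      sat M (satᵇᵘ M) τ (⋀ᵇ (allEquations (replicate m atom₀)))
    sat-allEquations zero    h = tt
    sat-allEquations (suc m) h = ⋀ᵇ-++ M (equations (zeros k)) _
      (sat-equations k (h ∘ ∈-++⁺ˡ)) (sat-allEquations m (h ∘ ∈-++⁺ʳ (fvᵗˢ (renameᵗˢ suc (zeros k)))))
      where k = arityᵘ S p

  fvᵘˢ-zeros : ∀ m → All (_≡ 0) (fvᵘˢ (replicate m atom₀))
  fvᵘˢ-zeros zero    = []
  fvᵘˢ-zeros (suc m) = All.++⁺ (fv-zeros (arityᵘ S p)) (fvᵘˢ-zeros m)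

  fvᵘˢ-ones : ∀ m → All (_≢ 0) (fvᵘˢ (map (renameᵘ suc) (replicate m atom₀)))
  fvᵘˢ-ones zero    = []
  fvᵘˢ-ones (suc m) = All.++⁺ (fv-ones (arityᵘ S p)) (fvᵘˢ-ones m)

  -- The trailing `[]` is the empty store to which Simplify adds the equations.
  answer : BUFormula
  answer = ex-except (fvᵍ goal) (allEquations (List⁺.toList heads) ++ [])

  goal-solved : SA CT (eraser ∷ []) goal
    answer
  goal-solved = _ , refl , introduce-all CT _ K [] [] ◅◅ simplify (here refl) fv K↭
                  (allEquations-EqAtoms K) applicable ◅ ε , halted CT _
    where
    K : List (Userᵃ S)
    K = List⁺.toList heads

    -- Introducing the atoms one by one reverses their order.
    K↭ : K ʳ++ [] ↭ K ++ []
    K↭ = ↭-trans (↭-reverse K) (↭-reflexive (sym (++-identityʳ K)))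

    applicable : Applicable CT [] (List⁺.map (renameᵘ suc) heads) (allEquations K) []
    -- All variables of the renamed head take the value `ρ 0` that the goal's variable already has,
    -- so both sides of each equation agree.
    applicable M m ρ _ = exs-const M _ ρ (ρ 0) _ λ τ h →
      sat-allEquations M (h 0 (inj₂ refl)) (suc n) (λ y∈ → h _ (inj₁ y∈)) , tt

    fvGoal : fvᵍ goal ≡ fvᵘˢ K
    fvGoal = concatMap-map fvᶜ user K

    zero-fvs : All (_≡ 0) (fvᵍ goal ++ fvConfig ⟨ [] , K ʳ++ [] , [] ⟩)
    zero-fvs = All.++⁺ (subst (All _) (sym fvGoal) (fvᵘˢ-zeros (suc n)))
      (All.++⁺ (All.anti-mono (concatMap⁺ fvᵘ (⊆-reflexive-↭ (↭-reverse K))) (fvᵘˢ-zeros (suc n))) [])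

    fv : FreshVariant (fvᵍ goal) ⟨ [] , K ʳ++ [] , [] ⟩ eraser (renameRule suc eraser)
    fv = record
      { σ         = suc
      ; injective = suc-injective
      ; renamed   = refl
      ; fresh     = All.++⁺ (All.map (λ y≢0 y∈ → y≢0 (All.lookup zero-fvs y∈)) (fvᵘˢ-ones (suc n))) []
      }

  -- Equations between variables hold when all variables share one value, whichever of them are
  -- quantified.
  answer-withoutUsers : ∀ M →
    let M' = withoutUsers M in
    sat M' (satᵇᵘ M') (const (Structure.inhabited M)) answer
  answer-withoutUsers M = exs-const M' (filter (_∉? fvᵍ goal) (fvᵇˢ E)) (const v) v (⋀ᵇ E) λ τ h →
    ⋀ᵇ-++ M' (allEquations (List⁺.toList heads)) []
      (sat-allEquations M' (h 0 (inj₂ refl)) (suc n) (λ {y} _ → h y (inj₂ refl))) tt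
    where
    M' = withoutUsers M
    v  = Structure.inhabited M
    E  = allEquations (List⁺.toList heads) ++ []

  goal-nontrivial : Consistent CT → ¬ Trivial CT goal answer
  -- Triviality would carry the true answer over to `atom₀`, which is false once user-defined
  -- predicates are empty; so CT would have no model.
  goal-nontrivial con triv = con λ M m _ →
    proj₁ (proj₁ (triv (withoutUsers M) (IsModel-withoutUsers M m) (const (Structure.inhabited M)))
      (answer-withoutUsers M))

-- Separation of the two programs

theorem5p1 : (S : Signature) → Πu S → (CT : Theory S) → Consistent CT →
    (n : ℕ) → n > 1 →
    ¬ (Σ (AcceptableEncoding CT (CHRᵈ CT (suc n)) (CHR n) U)
    AcceptableEncoding.GoalPreserving)
theorem5p1 S p CT con n _ (enc , preserving) =
  -- An answer of the encoded program for `⟦ G ⟧g` is pulled back to an answer of `ℙ` for `G`, which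
  -- has too few user-defined atoms for its rule.
  few-users-unsolvable CT (proj₁ ℙ) (≤-reflexive (sym length-heads) ∷ []) G ne few
    (_ , proj₁ (proj₂ (proj₂ (answers ℙ G tt) _ (proj₂ (solvable ⟦ G ⟧g (preserving G))))))
  where
  open AcceptableEncoding enc

  length-heads : List⁺.length (heads CT p n) ≡ suc n
  length-heads = cong suc (length-replicate n)

  ℙ : Σ (Program S) (CHRᵈ CT (suc n))
  ℙ = eraser CT p n ∷ [] , ≤-reflexive length-heads ∷ [] ,
      goal CT p n , _ , goal-solved CT p n , goal-nontrivial CT p n con

  G₀ : Goal S
  G₀ = goal CT p n

  encoded-users : users ⟨ ⟦ G₀ ⟧g , [] , [] ⟩ ≢ []
  encoded-users eq = ¬x∷xs↭[] (↭-trans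
    (usersᵍ-↭ (↭-sym (preserving G₀)))
    (↭-reflexive (trans (sym (++-identityʳ _)) eq)))

  encoded-solved = proj₁ (proj₂ (proj₁ (answers ℙ G₀ tt) _ (goal-solved CT p n)))

  -- The encoded program inherits the answer for `G₀`, and its heads have at most `n` atoms.
  vanishing = vanishing-point CT (proj₁ ⟦ ℙ ⟧) (proj₂ ⟦ ℙ ⟧) encoded-users
                (proj₁ (proj₂ (proj₂ encoded-solved)))

  G = proj₁ vanishing
  ne = proj₁ (proj₂ vanishing)
  few = proj₁ (proj₂ (proj₂ vanishing))
  solvable = proj₂ (proj₂ (proj₂ vanishing))
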